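{- Let $m,n,k_1,\dots,k_m,l_1,\dots,l_n$ be positive integers. Then for any integer $j$ with $1\le j\le m$, $$ \begin{aligned} z_{k_1}z_{k_2}\cdots z_{k_m}\overset{t}{\ast} z_{l_1}z_{l_2}\cdots z_{l_n} =\sum_{i=0}^{n}\Big[&\big(z_{k_1}\cdots z_{k_{j-1}}\overset{t}{\ast}_o z_{l_1}\cdots z_{l_i}\big)z_{k_j}\\ &+\big(z_{k_1}\cdots z_{k_{j-1}}\overset{t}{\ast}_o z_{l_1}\cdots z_{l_{i-1}}\big)\big\{(1-2t)z_{k_j+l_i}+(1-\delta_{i,n}\delta_{j,m})(t^2-t)x^{k_j+l_i}\big\}\Big]\\ &\times\big(z_{k_{j+1}}\cdots z_{k_m}\overset{t}{\ast} z_{l_{i+1}}\cdots z_{l_n}\big), \end{aligned} $$ where $z_{k_i}\cdots z_{k_{i-1}}=z_{l_i}\cdots z_{l_{i-1}}=1$ and $z_{k_i}\cdots z_{k_{i-2}}=z_{l_i}\cdots z_{l_{i-2}}=0$ for any integer $i$ (so, in particular, the second summand in the bracket is $0$ for $i=0$), and $\delta_{i,j}$ is Kronecker's delta.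
   Context: Let $A=\{x,y\}$ be two noncommuting letters, $A^*$ the set of all words in $A$ including the empty word $1$, and $\mathfrak{h}_t=\mathbb{Q}[t]\langle A\rangle$ the noncommutative polynomial algebra over $\mathbb{Q}[t]$ generated by $A$ (product = concatenation). Put $\mathfrak{h}_t^1=\mathbb{Q}[t]+\mathfrak{h}_t y$ and, for each positive integer $k$, $z_k=x^{k-1}y$. The t-stuffle product $\overset{t}{\ast}$ on $\mathfrak{h}_t^1$ is the $\mathbb{Q}[t]$-bilinear product determined by: (i) $1\overset{t}{\ast}w=w\overset{t}{\ast}1=w$; (ii) $$z_kw_1\overset{t}{\ast} z_lw_2 = z_k(w_1\overset{t}{\ast} z_lw_2) + z_l(z_kw_1\overset{t}{\ast} w_2)+(1-2t)z_{k+l}(w_1\overset{t}{\ast} w_2)+ [1-\delta(w_1)\delta(w_2)](t^2-t)x^{k+l}(w_1\overset{t}{\ast} w_2)$$ for all words $w,w_1,w_2\in A^*\cap\mathfrak{h}_t^1$ and all positive integers $k,l$, where $\delta(w)=1$ if $w=1$ and $\delta(w)=0$ otherwise. The product $\overset{t}{\ast}_o:\mathfrak{h}_t^1\times\mathfrak{h}_t^1\to\mathfrak{h}_t$ is the $\mathbb{Q}[t]$-bilinear map determined by $1\overset{t}{\ast}_o w=w\overset{t}{\ast}_o 1=w$ and $$z_kw_1\overset{t}{\ast}_o z_lw_2 = z_k(w_1\overset{t}{\ast}_o z_lw_2) + z_l(z_kw_1\overset{t}{\ast}_o w_2)+\{(1-2t)z_{k+l}+(t^2-t)x^{k+l}\}(w_1\overset{t}{\ast}_o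 w_2)$$ for words $w,w_1,w_2\in A^*\cap\mathfrak{h}_t^1$ and positive integers $k,l$. -}

module Defs where

open import Algebra.Bundles.Raw using (RawRing)
open import Data.Bool.Base using (if_then_else_)
open import Data.Fin.Base as Fin using (Fin; toℕ)
open import Data.List.Base using (List; []; _∷_; [_]; _++_; map; foldr; cartesianProductWith; replicate; take)
open import Data.List.Properties using (≡-dec)
open import Data.Nat.Base as ℕ using (ℕ; NonZero)
open import Data.Nat.Properties as ℕ using ()
open import Data.Product.Base using (_×_; _,_; map₁)
open import Data.Rational.Base using (+-*-rawRing)
open import Data.Vec.Base using (Vec; lookup; toList)
open import Level using (Level; _⊔_)
open import Relation.Binary.Definitions using (DecidableEquality)
open import Relation.Binary.PropositionalEquality.Core using (refl; cong)
open import Relation.Nullary.Decidable using (yes; no; does; map′)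

import Algebra.Definitions.RawMonoid as RawMonoidDefinitions

-- The monoid algebra R[M]: an element is a formal finite sum of terms c·u,
-- with repetitions and zero coefficients allowed, and two sums are equal when
-- every u ∈ M has the same total coefficient in both.
module MonoidAlgebra
  {r ℓ a : Level} (R : RawRing r ℓ)
  {M : Set a} (_∙_ : M → M → M) (ε : M) (_≟_ : DecidableEquality M)
  where

  private module R = RawRing R

  infix  8 -_
  infixr 8 _•_
  infixl 7 _*_
  infixl 6 _+_ _-_
  infix  4 _≈_

  Carrier : Set (r ⊔ a)
  Carrier = List (R.Carrier × M)

  coeff : Carrier → M → R.Carrier
  coeff p w = foldr (λ (c , u) s → if does (u ≟ w) then c R.+ s else s) R.0# p

  record _≈_ (p q : Carrier) : Set (ℓ ⊔ a) where
    constructor coeffwise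
    field coeff-≈ : ∀ w → coeff p w R.≈ coeff q w

  monomial : R.Carrier → M → Carrier
  monomial c u = [ c , u ]

  basis : M → Carrier
  basis = monomial R.1#

  0# 1# : Carrier
  0# = []
  1# = basis ε

  _+_ : Carrier → Carrier → Carrier
  _+_ = _++_

  _*_ : Carrier → Carrier → Carrier
  _*_ = cartesianProductWith (λ (c , u) (d , v) → c R.* d , u ∙ v)

  -_ : Carrier → Carrier
  -_ = map (map₁ R.-_)

  _-_ : Carrier → Carrier → Carrier
  p - q = p + (- q)

  _•_ : R.Carrier → Carrier → Carrier
  c • p = map (map₁ (c R.*_)) p

  rawRing : RawRing (r ⊔ a) (ℓ ⊔ a)
  rawRing = record
    { Carrier = Carrier ; _≈_ = _≈_
    ; _+_ = _+_ ; _*_ = _*_ ; -_ = -_ ; 0# = 0# ; 1# = 1# }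

  open RawMonoidDefinitions (RawRing.+-rawMonoid rawRing) public using (sum)

-- ℚ[t] as the monoid algebra of (ℕ , +): the exponent n stands for tⁿ.
module ℚ[t] = MonoidAlgebra +-*-rawRing ℕ._+_ 0 ℕ._≟_

open ℚ[t] public using () renaming
  (Carrier to ℚ[t]; 0# to 0ₜ; 1# to 1ₜ; _+_ to _+ₜ_; _*_ to _*ₜ_; _-_ to _-ₜ_)

t 1-2t t²-t : ℚ[t]
t    = ℚ[t].basis 1
1-2t = 1ₜ -ₜ (t +ₜ t)
t²-t = (t *ₜ t) -ₜ t

δ⟨_,_⟩ : ℕ → ℕ → ℚ[t]
δ⟨ i , j ⟩ = if does (i ℕ.≟ j) then 1ₜ else 0ₜ

data Letter : Set where
  x y : Letter

_≟ᴸ_ : DecidableEquality Letter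
x ≟ᴸ x = yes refl
x ≟ᴸ y = no λ ()
y ≟ᴸ x = no λ ()
y ≟ᴸ y = yes refl

Word : Set
Word = List Letter

module 𝔥 = MonoidAlgebra ℚ[t].rawRing {M = Word} _++_ [] (≡-dec _≟ᴸ_)

open 𝔥 public using (_≈_; _+_; _*_; _•_; sum) renaming (Carrier to 𝔥)

record ℕ⁺ : Set where
  constructor pos
  field
    value       : ℕ
    .{{nonZero}} : NonZero value

open ℕ⁺ using (value)

_≟⁺_ : DecidableEquality ℕ⁺
k ≟⁺ l = map′ (λ { refl → refl }) (cong value) (value k ℕ.≟ value l)

infixl 6 _+⁺_

_+⁺_ : ℕ⁺ → ℕ⁺ → ℕ⁺
pos (ℕ.suc k) +⁺ l = pos (ℕ.suc k ℕ.+ value l)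

zᵂ : ℕ⁺ → Word
zᵂ k = replicate (ℕ.pred (value k)) x ++ [ y ]

z : ℕ⁺ → 𝔥
z k = 𝔥.basis (zᵂ k)

x^ : ℕ⁺ → 𝔥
x^ k = 𝔥.basis (replicate (value k) x)

-- A word in x and y is empty or ends in y exactly when it is a product
-- z_{k₁} ⋯ z_{kᵣ}, and k₁, …, kᵣ are then unique. So the list k₁ ∷ … ∷ kᵣ
-- stands for that word, and 𝔥¹ = ℚ[t] + 𝔥 y has these words as its basis.
ZWord : Set
ZWord = List ℕ⁺

module 𝔥¹ = MonoidAlgebra ℚ[t].rawRing {M = ZWord} _++_ [] (≡-dec _≟⁺_)

open 𝔥¹ public using () renaming (Carrier to 𝔥¹; basis to z⟨_⟩)

toWord : ZWord → Word
toWord = foldr (λ k w → zᵂ k ++ w) []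

ι : ZWord → 𝔥
ι w = 𝔥.basis (toWord w)

δ : ZWord → ℚ[t]
δ []      = 1ₜ
δ (_ ∷ _) = 0ₜ

stuffle : ZWord → ZWord → 𝔥
stuffle []         w          = ι w
stuffle w@(_ ∷ _)  []         = ι w
stuffle (k ∷ w₁)   (l ∷ w₂)   =
    z k * stuffle w₁ (l ∷ w₂)
  + z l * stuffle (k ∷ w₁) w₂
  + 1-2t • (z (k +⁺ l) * stuffle w₁ w₂)
  + ((1ₜ -ₜ δ w₁ *ₜ δ w₂) *ₜ t²-t) • (x^ (k +⁺ l) * stuffle w₁ w₂)

stuffleₒ : ZWord → ZWord → 𝔥
stuffleₒ []        w        = ι w
stuffleₒ w@(_ ∷ _) []       = ι w
stuffleₒ (k ∷ w₁)  (l ∷ w₂) =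
    z k * stuffleₒ w₁ (l ∷ w₂)
  + z l * stuffleₒ (k ∷ w₁) w₂
  + (1-2t • z (k +⁺ l) + t²-t • x^ (k +⁺ l)) * stuffleₒ w₁ w₂

bilinear : (ZWord → ZWord → 𝔥) → 𝔥¹ → 𝔥¹ → 𝔥
bilinear f p q =
  foldr _+_ 𝔥.0# (cartesianProductWith (λ (c , u) (d , v) → (c *ₜ d) • f u v) p q)

infixl 7 _∗_ _∗ₒ_

-- The values of _∗_ lie in the submodule 𝔥¹ of 𝔥, those of _∗ₒ_ need not.
_∗_ _∗ₒ_ : 𝔥¹ → 𝔥¹ → 𝔥
_∗_  = bilinear stuffle
_∗ₒ_ = bilinear stuffleₒ

-- The summand (z_{k₁}⋯z_{kⱼ₋₁} ∗ₒ z_{l₁}⋯z_{lᵢ₋₁}){…}, for 0 ≤ i ≤ n. The empty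
-- range of length -1 occurring at i = 0 denotes 0. An index j : Fin m is
-- counted from 0, so it stands for the j + 1 of 1, …, m.
merged : ∀ {m n} → Vec ℕ⁺ m → Vec ℕ⁺ n → Fin m → Fin (ℕ.suc n) → 𝔥
merged k l j Fin.zero = 𝔥.0#
merged {m} {n} k l j (Fin.suc i) =
    (z⟨ take (toℕ j) (toList k) ⟩ ∗ₒ z⟨ take (toℕ i) (toList l) ⟩)
  * ( 1-2t • z (lookup k j +⁺ lookup l i)
    + ((1ₜ -ₜ δ⟨ ℕ.suc (toℕ i) , n ⟩ *ₜ δ⟨ ℕ.suc (toℕ j) , m ⟩) *ₜ t²-t)
        • x^ (lookup k j +⁺ lookup l i))

{-# OPTIONS --safe #-}

-- Cut z_{l₁} ⋯ z_{lₙ} where z_{kⱼ} is used up. The part before the cut enters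
-- through ∗ₒ; the part after it contributes those terms of its product with
-- z_{kⱼ} ⋯ z_{kₘ} that take z_{kⱼ} first, alone or merged with the next letter.
-- The sum over all cuts is a convolution, linear in its first factor, and the
-- recursions of ∗ and ∗ₒ match by induction on the letters before z_{kⱼ}.
-- Nothing cancels, so both sides agree even as multisets of terms, that is
-- modulo _↭_, for which 𝔥 is a semiring.
module Submission where

open import Defs using (module MonoidAlgebra)
open import Algebra.Bundles using (CommutativeMonoid; Semiring)
open import Algebra.Bundles.Raw using (RawRing)
import Algebra.Properties.CommutativeSemigroup as CommutativeSemigroupProperties
import Algebra.Properties.Semiring.Sum as SemiringSum
open import Algebra.Structures using (IsMonoid; IsCommutativeMonoid)
open import Data.Bool.Base using (true; false)
open import Data.Fin.Base as Fin using (Fin; toℕ; inject₁; fromℕ)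
open import Data.Fin.Properties using (toℕ-inject₁; toℕ-fromℕ)
open import Data.List.Base using (List; []; _∷_; [_]; _++_; map; take; drop; cartesianProductWith)
open import Data.List.Properties as List using ()
open import Data.List.Relation.Binary.Permutation.Propositional as ↭ using (_↭_; ↭-reflexive)
open import Data.List.Relation.Binary.Permutation.Propositional.Properties
open import Data.Nat.Base as ℕ using (ℕ; suc; NonZero)
open import Data.Nat.Properties as ℕ using ()
open import Data.Product.Base using (_×_; _,_; map₁)
open import Data.Rational.Base using (+-*-rawRing)
open import Data.Rational.Properties as ℚ using ()
open import Data.Vec.Base using (Vec; []; _∷_; lookup; toList)
open import Function.Base using (_∘_)
open import Relation.Binary.Definitions using (DecidableEquality)
open import Relation.Binary.PropositionalEquality as ≡ using (_≡_; cong; cong₂; module ≡-Reasoning)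
import Relation.Binary.Reasoning.Setoid as SetoidReasoning
open import Relation.Nullary.Decidable using (does)

-- Lists over a monoid as a semiring modulo permutation.

module ListSemiring {a} {A : Set a} {_∙_ : A → A → A} {ε : A} (isMonoid : IsMonoid _≡_ _∙_ ε) where

  open IsMonoid isMonoid using (assoc; identityˡ; identityʳ)

  infixl 7 _⊛_

  _⊛_ : List A → List A → List A
  _⊛_ = cartesianProductWith _∙_

  ⊛-distribʳ : ∀ ps qs rs → (qs ++ rs) ⊛ ps ≡ qs ⊛ ps ++ rs ⊛ ps
  ⊛-distribʳ ps qs rs = List.cartesianProductWith-distribʳ-++ _∙_ qs rs ps

  map-∙-⊛ : ∀ p qs rs → map (p ∙_) qs ⊛ rs ≡ map (p ∙_) (qs ⊛ rs)
  map-∙-⊛ p []       rs = ≡.refl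
  map-∙-⊛ p (q ∷ qs) rs = begin
    map ((p ∙ q) ∙_) rs ++ map (p ∙_) qs ⊛ rs            ≡⟨ cong₂ _++_ (List.map-cong (assoc p q) rs) (map-∙-⊛ p qs rs) ⟩
    map (λ r → p ∙ (q ∙ r)) rs ++ map (p ∙_) (qs ⊛ rs)   ≡⟨ cong (_++ _) (List.map-∘ rs) ⟩
    map (p ∙_) (map (q ∙_) rs) ++ map (p ∙_) (qs ⊛ rs)   ≡⟨ List.map-++ (p ∙_) (map (q ∙_) rs) (qs ⊛ rs) ⟨
    map (p ∙_) (map (q ∙_) rs ++ qs ⊛ rs)                ∎
    where open ≡-Reasoning

  ⊛-assoc : ∀ ps qs rs → (ps ⊛ qs) ⊛ rs ≡ ps ⊛ (qs ⊛ rs)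
  ⊛-assoc []       qs rs = ≡.refl
  ⊛-assoc (p ∷ ps) qs rs = begin
    (map (p ∙_) qs ++ ps ⊛ qs) ⊛ rs         ≡⟨ ⊛-distribʳ rs (map (p ∙_) qs) (ps ⊛ qs) ⟩
    map (p ∙_) qs ⊛ rs ++ (ps ⊛ qs) ⊛ rs    ≡⟨ cong₂ _++_ (map-∙-⊛ p qs rs) (⊛-assoc ps qs rs) ⟩
    map (p ∙_) (qs ⊛ rs) ++ ps ⊛ (qs ⊛ rs)  ∎
    where open ≡-Reasoning

  ⊛-identityˡ : ∀ ps → [ ε ] ⊛ ps ≡ ps
  ⊛-identityˡ ps = begin
    map (ε ∙_) ps ++ []  ≡⟨ List.++-identityʳ _ ⟩
    map (ε ∙_) ps        ≡⟨ List.map-cong identityˡ ps ⟩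
    map (λ p → p) ps     ≡⟨ List.map-id ps ⟩
    ps                   ∎
    where open ≡-Reasoning

  ⊛-identityʳ : ∀ ps → ps ⊛ [ ε ] ≡ ps
  ⊛-identityʳ []       = ≡.refl
  ⊛-identityʳ (p ∷ ps) = cong₂ _∷_ (identityʳ p) (⊛-identityʳ ps)

  -- These laws hold as equalities of lists, so the construction can be iterated: elements of `ℚ[t]`
  -- are such lists and serve in turn as coefficients in `𝔥`.
  ⊛-isMonoid : IsMonoid _≡_ _⊛_ [ ε ]
  ⊛-isMonoid = record
    { isSemigroup = record
      { isMagma = record { isEquivalence = ≡.isEquivalence ; ∙-cong = cong₂ _⊛_ }
      ; assoc   = ⊛-assoc
      }
    ; identity = ⊛-identityˡ , ⊛-identityʳ
    }

  ⊛-congˡ : ∀ ps {qs rs} → qs ↭ rs → ps ⊛ qs ↭ ps ⊛ rs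
  ⊛-congˡ []       qs↭rs = ↭.refl
  ⊛-congˡ (p ∷ ps) qs↭rs = ++⁺ (map⁺ (p ∙_) qs↭rs) (⊛-congˡ ps qs↭rs)

  -- Each entry of the left factor contributes one contiguous block, so swapping two entries swaps
  -- two blocks.
  ⊛-congʳ : ∀ ps {qs rs} → qs ↭ rs → qs ⊛ ps ↭ rs ⊛ ps
  ⊛-congʳ ps ↭.refl = ↭.refl
  ⊛-congʳ ps (↭.prep q qs↭rs) = ++⁺ˡ (map (q ∙_) ps) (⊛-congʳ ps qs↭rs)
  ⊛-congʳ ps (↭.swap q r qs↭rs) = ↭.trans
    (shifts (map (q ∙_) ps) (map (r ∙_) ps))
    (++⁺ˡ (map (r ∙_) ps) (++⁺ˡ (map (q ∙_) ps) (⊛-congʳ ps qs↭rs)))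
  ⊛-congʳ ps (↭.trans qs↭rs rs↭ss) = ↭.trans (⊛-congʳ ps qs↭rs) (⊛-congʳ ps rs↭ss)

  -- The blocks of a product follow its left factor, so products with `qs` and with `rs` alternate
  -- on one side and are separated on the other. Here, as for commutativity of addition, equality of
  -- lists gives way to `_↭_`.
  ⊛-distribˡ : ∀ ps qs rs → ps ⊛ (qs ++ rs) ↭ ps ⊛ qs ++ ps ⊛ rs
  ⊛-distribˡ []       qs rs = ↭.refl
  ⊛-distribˡ (p ∷ ps) qs rs = ↭.trans
    (++⁺ (↭-reflexive (List.map-++ (p ∙_) qs rs)) (⊛-distribˡ ps qs rs))
    (interchange (map (p ∙_) qs) (map (p ∙_) rs) (ps ⊛ qs) (ps ⊛ rs))
    where
    open CommutativeMonoid (++-commutativeMonoid {A = A}) using (commutativeSemigroup)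
    open CommutativeSemigroupProperties commutativeSemigroup using (interchange)

  semiring : Semiring a a
  semiring = record
    { isSemiring = record
      { isSemiringWithoutAnnihilatingZero = record
        { +-isCommutativeMonoid = ++-isCommutativeMonoid
        ; *-cong     = λ {ps} {qs} {rs} {ss} ps↭qs rs↭ss → ↭.trans (⊛-congʳ rs ps↭qs) (⊛-congˡ qs rs↭ss)
        ; *-assoc    = λ ps qs rs → ↭-reflexive (⊛-assoc ps qs rs)
        ; *-identity = (λ ps → ↭-reflexive (⊛-identityˡ ps)) , (λ ps → ↭-reflexive (⊛-identityʳ ps))
        ; distrib    = ⊛-distribˡ , (λ ps qs rs → ↭-reflexive (⊛-distribʳ ps qs rs))
        }
      ; zero = (λ _ → ↭.refl) , (λ ps → ↭-reflexive (List.cartesianProductWith-zeroʳ _∙_ ps))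
      }
    }

-- Monoid algebras: reordering terms preserves coefficients.

module MonoidAlgebraProperties
  {r ℓ a} (R : RawRing r ℓ)
  (+ᴿ-isCommutativeMonoid : IsCommutativeMonoid (RawRing._≈_ R) (RawRing._+_ R) (RawRing.0# R))
  (*ᴿ-isMonoid : IsMonoid _≡_ (RawRing._*_ R) (RawRing.1# R))
  {M : Set a} {_∙_ : M → M → M} {ε : M} (∙-isMonoid : IsMonoid _≡_ _∙_ ε)
  (_≟_ : DecidableEquality M)
  where

  open RawRing R using () renaming (_≈_ to _≈ᴿ_; _+_ to _+ᴿ_; _*_ to _*ᴿ_; 1# to 1ᴿ)
  open MonoidAlgebra R _∙_ ε _≟_
  private
    module +ᴿ = IsCommutativeMonoid +ᴿ-isCommutativeMonoid
    module *ᴿ = IsMonoid *ᴿ-isMonoid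
    module ∙ = IsMonoid ∙-isMonoid

  -- Coefficients are multiplied term by term, where the laws hold for `_≡_`; they are added only
  -- inside `coeff`, where `_≈ᴿ_` suffices.
  term-isMonoid : IsMonoid {A = RawRing.Carrier R × M} _≡_ (λ (c , u) (d , v) → c *ᴿ d , u ∙ v) (1ᴿ , ε)
  term-isMonoid = record
    { isSemigroup = record
      { isMagma = record { isEquivalence = ≡.isEquivalence ; ∙-cong = cong₂ _ }
      ; assoc   = λ (c , u) (d , v) (e , w) → cong₂ _,_ (*ᴿ.assoc c d e) (∙.assoc u v w)
      }
    ; identity = (λ (c , u) → cong₂ _,_ (*ᴿ.identityˡ c) (∙.identityˡ u))
               , (λ (c , u) → cong₂ _,_ (*ᴿ.identityʳ c) (∙.identityʳ u))
    }

  open ListSemiring term-isMonoid public using (semiring) renaming (⊛-isMonoid to *-isMonoid)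

  •-*-assoc : ∀ c p q → c • (p * q) ≡ (c • p) * q
  •-*-assoc c []             q = ≡.refl
  •-*-assoc c ((d , u) ∷ p)  q = begin
    c • (map (λ (e , v) → d *ᴿ e , u ∙ v) q + p * q)
      ≡⟨ List.map-++ (map₁ (c *ᴿ_)) (map (λ (e , v) → d *ᴿ e , u ∙ v) q) (p * q) ⟩
    c • map (λ (e , v) → d *ᴿ e , u ∙ v) q + c • (p * q)
      ≡⟨ cong₂ _+_ (≡.trans (≡.sym (List.map-∘ q)) (List.map-cong (λ (e , _) → cong (_, _) (≡.sym (*ᴿ.assoc c d e))) q))
                   (•-*-assoc c p q) ⟩
    map (λ (e , v) → (c *ᴿ d) *ᴿ e , u ∙ v) q + (c • p) * q ∎
    where open ≡-Reasoning

  *-distribʳ-+ : ∀ p q r → (q + r) * p ≡ q * p + r * p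
  *-distribʳ-+ p q r = List.cartesianProductWith-distribʳ-++ _ q r p

  1#• : ∀ p → 1ᴿ • p ≡ p
  1#• p = ≡.trans (List.map-cong (λ (c , _) → cong (_, _) (*ᴿ.identityˡ c)) p) (List.map-id p)

  basis-* : ∀ u v → basis u * basis v ≡ basis (u ∙ v)
  basis-* u v = cong (λ c → [ c , u ∙ v ]) (*ᴿ.identityˡ 1ᴿ)

  coeff-∷-cong : ∀ {c u w} p q → coeff p w ≈ᴿ coeff q w → coeff ((c , u) ∷ p) w ≈ᴿ coeff ((c , u) ∷ q) w
  coeff-∷-cong {u = u} {w} p q eq with does (u ≟ w)
  ... | true  = +ᴿ.∙-congˡ eq
  ... | false = eq

  coeff-∷-swap : ∀ s t p w → coeff (s ∷ t ∷ p) w ≈ᴿ coeff (t ∷ s ∷ p) w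
  coeff-∷-swap (c , u) (d , v) p w with does (u ≟ w) | does (v ≟ w)
  ... | true  | true  = +ᴿ.trans (+ᴿ.sym (+ᴿ.assoc _ _ _)) (+ᴿ.trans (+ᴿ.∙-congʳ (+ᴿ.comm _ _)) (+ᴿ.assoc _ _ _))
  ... | true  | false = +ᴿ.refl
  ... | false | true  = +ᴿ.refl
  ... | false | false = +ᴿ.refl

  -- A coefficient sums over the terms at `w`, so reordering terms reorders summands in a
  -- commutative monoid. Commutativity enters only when both swapped terms lie at `w`.
  coeff-↭ : ∀ {p q} → p ↭ q → ∀ w → coeff p w ≈ᴿ coeff q w
  coeff-↭ ↭.refl w = +ᴿ.refl
  coeff-↭ (↭.prep {p} {q} _ p↭q) w = coeff-∷-cong p q (coeff-↭ p↭q w)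
  coeff-↭ (↭.swap {p} {q} s t p↭q) w = +ᴿ.trans
    (coeff-∷-swap s t p w)
    (coeff-∷-cong (s ∷ p) (s ∷ q) (coeff-∷-cong p q (coeff-↭ p↭q w)))
  coeff-↭ (↭.trans p↭q q↭r) w = +ᴿ.trans (coeff-↭ p↭q w) (coeff-↭ q↭r w)

  ↭⇒≈ : ∀ {p q} → p ↭ q → p ≈ q
  ↭⇒≈ p↭q = coeffwise (coeff-↭ p↭q)

  coeff-+ : ∀ p q w → coeff (p + q) w ≈ᴿ coeff p w +ᴿ coeff q w
  coeff-+ []             q w = +ᴿ.sym (+ᴿ.identityˡ _)
  coeff-+ ((c , u) ∷ p)  q w with does (u ≟ w)
  ... | true  = +ᴿ.trans (+ᴿ.∙-congˡ (coeff-+ p q w)) (+ᴿ.sym (+ᴿ.assoc _ _ _))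
  ... | false = coeff-+ p q w

  -- For `ℚ[t]` this supplies the additive hypothesis on the coefficients of `𝔥`.
  +-isCommutativeMonoid : IsCommutativeMonoid _≈_ _+_ 0#
  +-isCommutativeMonoid = record
    { isMonoid = record
      { isSemigroup = record
        { isMagma = record
          { isEquivalence = record
            { refl  = coeffwise λ _ → +ᴿ.refl
            ; sym   = λ (coeffwise eq) → coeffwise λ w → +ᴿ.sym (eq w)
            ; trans = λ (coeffwise eq₁) (coeffwise eq₂) → coeffwise λ w → +ᴿ.trans (eq₁ w) (eq₂ w)
            }
          ; ∙-cong = λ {p} {q} {r} {s} (coeffwise eq₁) (coeffwise eq₂) → coeffwise λ w →
              +ᴿ.trans (coeff-+ p r w) (+ᴿ.trans (+ᴿ.∙-cong (eq₁ w) (eq₂ w)) (+ᴿ.sym (coeff-+ q s w)))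
          }
        ; assoc = λ p q r → ↭⇒≈ (++-assoc p q r)
        }
      ; identity = (λ p → ↭⇒≈ ↭.refl) , (λ p → ↭⇒≈ (++-identityʳ p))
      }
    ; comm = λ p q → ↭⇒≈ (++-comm p q)
    }

-- Convolution over the cuts of a list.

module Convolution {c ℓ} (S : Semiring c ℓ) where

  open Semiring S
  open SemiringSum S

  infixl 7 _⋆_

  -- The convolution dual to deconcatenation. Taking a vector fixes the `suc n` cuts, both ends
  -- included, as the index set of the sum in the theorem.
  _⋆_ : ∀ {b} {B : Set b} → (List B → Carrier) → (List B → Carrier) → ∀ {n} → Vec B n → Carrier
  (F ⋆ G) {n} l = ∑[ i ≤ n ] (F (take (toℕ i) (toList l)) * G (drop (toℕ i) (toList l)))

  module _ {b} {B : Set b} where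

    ⋆-congʳ : ∀ {F F′} (G : List B → Carrier) → (∀ u → F u ≈ F′ u) → ∀ {n} (l : Vec B n) → (F ⋆ G) l ≈ (F′ ⋆ G) l
    ⋆-congʳ G F≈F′ {n} l = sum-cong-≋ {suc n} λ i → *-congʳ {G (drop (toℕ i) (toList l))} (F≈F′ (take (toℕ i) (toList l)))

    ⋆-distribʳ-+ : ∀ F F′ (G : List B → Carrier) {n} (l : Vec B n) →
                   ((λ u → F u + F′ u) ⋆ G) l ≈ (F ⋆ G) l + (F′ ⋆ G) l
    ⋆-distribʳ-+ F F′ G {n} l = trans
      (sum-cong-≋ {suc n} λ i → distribʳ (tail i) (F (init i)) (F′ (init i)))
      (∑-distrib-+ {suc n} (λ i → F (init i) * tail i) (λ i → F′ (init i) * tail i))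
      where
      init = λ (i : Fin (suc n)) → take (toℕ i) (toList l)
      tail = λ (i : Fin (suc n)) → G (drop (toℕ i) (toList l))

    *-⋆ : ∀ a F (G : List B → Carrier) {n} (l : Vec B n) → a * (F ⋆ G) l ≈ ((λ u → a * F u) ⋆ G) l
    *-⋆ a F G {n} l = trans
      (*-distribˡ-sum {suc n} a (λ i → F (init i) * tail i))
      (sum-cong-≋ {suc n} λ i → sym (*-assoc a (F (init i)) (tail i)))
      where
      init = λ (i : Fin (suc n)) → take (toℕ i) (toList l)
      tail = λ (i : Fin (suc n)) → G (drop (toℕ i) (toList l))

drop-lookup : ∀ {a} {A : Set a} {n} (v : Vec A n) (i : Fin n) →
              drop (toℕ i) (toList v) ≡ lookup v i ∷ drop (suc (toℕ i)) (toList v)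
drop-lookup (a ∷ v) Fin.zero    = ≡.refl
drop-lookup (a ∷ v) (Fin.suc i) = drop-lookup v i

drop-length : ∀ {a} {A : Set a} {n} (v : Vec A n) → drop n (toList v) ≡ []
drop-length []      = ≡.refl
drop-length (_ ∷ v) = drop-length v

-- Instances for `ℚ[t]` and `𝔥`, and the factors δ.

open import Defs hiding (module MonoidAlgebra)

module ℚ[t]ₚ = MonoidAlgebraProperties
  +-*-rawRing ℚ.+-0-isCommutativeMonoid ℚ.*-1-isMonoid ℕ.+-0-isMonoid ℕ._≟_

module 𝔥ₚ = MonoidAlgebraProperties
  ℚ[t].rawRing ℚ[t]ₚ.+-isCommutativeMonoid ℚ[t]ₚ.*-isMonoid {M = Word} List.++-isMonoid (List.≡-dec _≟ᴸ_)

-- The rest after a letter is empty exactly when that letter is the last one. This turns the δ of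
-- the recursion into the Kronecker deltas of the theorem; `suc` appears because `i` counts from 0.
δ-drop : ∀ {n} (v : Vec ℕ⁺ n) (i : Fin n) → δ (drop (suc (toℕ i)) (toList v)) ≡ δ⟨ suc (toℕ i) , n ⟩
δ-drop (_ ∷ [])    Fin.zero    = ≡.refl
δ-drop (_ ∷ _ ∷ _) Fin.zero    = ≡.refl
δ-drop (_ ∷ v)     (Fin.suc i) = δ-drop v i

-- The theorem and the recursion list the two deltas in opposite orders. Strict equality is wanted,
-- since `_↭_` compares coefficients as lists; it holds because each delta is `0ₜ` or `1ₜ`.
δ⟨⟩-*ₜ-comm : ∀ i j m n → δ⟨ i , j ⟩ *ₜ δ⟨ m , n ⟩ ≡ δ⟨ m , n ⟩ *ₜ δ⟨ i , j ⟩
δ⟨⟩-*ₜ-comm i j m n with does (i ℕ.≟ j) | does (m ℕ.≟ n)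
... | true  | true  = ≡.refl
... | true  | false = ≡.refl
... | false | true  = ≡.refl
... | false | false = ≡.refl

δ-++-∷ : ∀ u a v → δ (u ++ a ∷ v) ≡ 0ₜ
δ-++-∷ []      a v = ≡.refl
δ-++-∷ (_ ∷ _) a v = ≡.refl

-- The stuffle recursions and the sum over cuts.

open Semiring 𝔥ₚ.semiring
  using (+-cong; +-congˡ; +-congʳ; +-assoc; +-identityʳ; *-congˡ; *-assoc; *-identityˡ; distribˡ; distribʳ; setoid)
  renaming (sym to ≈-sym; trans to ≈-trans; reflexive to ≈-reflexive)
open SemiringSum 𝔥ₚ.semiring using (sum-cong-≋; sum-init-last; ∑-distrib-+)
open Convolution 𝔥ₚ.semiring

-- The scalar `c` tells the two recursions apart: `weight u v` belongs to `stuffle`, `t²-t` to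
-- `stuffleₒ`.
merge : ℚ[t] → ℕ⁺ → ℕ⁺ → 𝔥
merge c k l = 1-2t • z (k +⁺ l) + c • x^ (k +⁺ l)

merge-* : ∀ c k l p → 1-2t • (z (k +⁺ l) * p) + c • (x^ (k +⁺ l) * p) ≡ merge c k l * p
merge-* c k l p = ≡.trans
  (cong₂ _+_ (𝔥ₚ.•-*-assoc 1-2t (z (k +⁺ l)) p) (𝔥ₚ.•-*-assoc c (x^ (k +⁺ l)) p))
  (≡.sym (𝔥ₚ.*-distribʳ-+ p (1-2t • z (k +⁺ l)) (c • x^ (k +⁺ l))))

weight : ZWord → ZWord → ℚ[t]
weight u v = (1ₜ -ₜ δ u *ₜ δ v) *ₜ t²-t

ι-∷ : ∀ k u → z k * ι u ≡ ι (k ∷ u)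
ι-∷ k u = 𝔥ₚ.basis-* (zᵂ k) (toWord u)

stuffle-[]ʳ : ∀ u → stuffle u [] ≡ ι u
stuffle-[]ʳ []      = ≡.refl
stuffle-[]ʳ (_ ∷ _) = ≡.refl

stuffleₒ-[]ʳ : ∀ u → stuffleₒ u [] ≡ ι u
stuffleₒ-[]ʳ []      = ≡.refl
stuffleₒ-[]ʳ (_ ∷ _) = ≡.refl

-- Gathering the two merging terms into one left factor gives the recursion the shape of that of
-- `stuffleₒ`.
stuffle-∷-∷ : ∀ k u l v → stuffle (k ∷ u) (l ∷ v) ≡
  z k * stuffle u (l ∷ v) + z l * stuffle (k ∷ u) v + merge (weight u v) k l * stuffle u v
stuffle-∷-∷ k u l v = ≡.trans
  (List.++-assoc (z k * stuffle u (l ∷ v) + z l * stuffle (k ∷ u) v) _ _)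
  (cong (z k * stuffle u (l ∷ v) + z l * stuffle (k ∷ u) v +_) (merge-* (weight u v) k l (stuffle u v)))

-- lead a w v consists of the terms of z_a w ∗ v that come from taking z_a first,
-- alone or merged with the first z_l of v.
mergeHead lead : ℕ⁺ → ZWord → ZWord → 𝔥
mergeHead a w []      = 𝔥.0#
mergeHead a w (l ∷ v) = merge (weight w v) a l * stuffle w v
lead a w v = z a * stuffle w v + mergeHead a w v

-- Nested induction on `u` and `l`. The second factor `lead a w` never changes; the recursion acts
-- only on the first one, where it builds up `stuffleₒ`.
stuffle-⋆ : ∀ u a w {n} (l : Vec ℕ⁺ n) → stuffle (u ++ a ∷ w) (toList l) ↭ (stuffleₒ u ⋆ lead a w) l
stuffle-⋆ [] a w [] = begin
  ι (a ∷ w)                                 ≡⟨ ι-∷ a w ⟨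
  z a * ι w                                 ≡⟨ cong (z a *_) (stuffle-[]ʳ w) ⟨
  z a * stuffle w []                        ≈⟨ +-identityʳ (z a * stuffle w []) ⟨
  lead a w []                               ≈⟨ *-identityˡ (lead a w []) ⟨
  ι [] * lead a w []                        ≈⟨ +-identityʳ (ι [] * lead a w []) ⟨
  (ι ⋆ lead a w) []                         ∎
  where open SetoidReasoning setoid
stuffle-⋆ [] a w (b ∷ l) = begin
  stuffle (a ∷ w) (b ∷ v)
    ≡⟨ stuffle-∷-∷ a w b v ⟩
  z a * stuffle w (b ∷ v) + z b * stuffle (a ∷ w) v + merge (weight w v) a b * stuffle w v
    -- The two terms that use up `z a`, alone or merged with `z b`, form the cut at 0. In the
    -- remaining one `z b` precedes `z a`, so `b` joins the prefix of every later cut.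
    ≈⟨ xy∙z≈xz∙y (z a * stuffle w (b ∷ v)) (z b * stuffle (a ∷ w) v) (merge (weight w v) a b * stuffle w v) ⟩
  lead a w (b ∷ v) + z b * stuffle (a ∷ w) v
    ≈⟨ +-cong (≈-sym (*-identityˡ (lead a w (b ∷ v)))) (*-congˡ {z b} (stuffle-⋆ [] a w l)) ⟩
  ι [] * lead a w (b ∷ v) + z b * (ι ⋆ lead a w) l
    ≈⟨ +-congˡ {ι [] * lead a w (b ∷ v)} (*-⋆ (z b) ι (lead a w) l) ⟩
  ι [] * lead a w (b ∷ v) + ((λ s → z b * ι s) ⋆ lead a w) l
    ≈⟨ +-congˡ {ι [] * lead a w (b ∷ v)} (⋆-congʳ (lead a w) (λ s → ≈-reflexive (ι-∷ b s)) l) ⟩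
  (ι ⋆ lead a w) (b ∷ l) ∎
  where
  v = toList l
  open SetoidReasoning setoid
  open CommutativeSemigroupProperties (Semiring.+-commutativeSemigroup 𝔥ₚ.semiring) using (xy∙z≈xz∙y)
stuffle-⋆ (k ∷ u) a w [] = begin
  ι (k ∷ u ++ a ∷ w)                                     ≡⟨ ι-∷ k (u ++ a ∷ w) ⟨
  z k * ι (u ++ a ∷ w)                                   ≡⟨ cong (z k *_) (stuffle-[]ʳ (u ++ a ∷ w)) ⟨
  z k * stuffle (u ++ a ∷ w) []                          ≈⟨ *-congˡ {z k} (stuffle-⋆ u a w []) ⟩
  z k * (stuffleₒ u ⋆ lead a w) []                       ≈⟨ *-⋆ (z k) (stuffleₒ u) (lead a w) [] ⟩
  (z k * stuffleₒ u []) * lead a w [] + 𝔥.0#             ≡⟨ cong (λ p → p * lead a w [] + 𝔥.0#) (≡.trans (cong (z k *_) (stuffleₒ-[]ʳ u)) (ι-∷ k u)) ⟩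
  (stuffleₒ (k ∷ u) ⋆ lead a w) []                       ∎
  where open SetoidReasoning setoid
stuffle-⋆ (k ∷ u) a w (b ∷ l) = begin
  stuffle (k ∷ s) (b ∷ v)
    ≡⟨ stuffle-∷-∷ k s b v ⟩
  z k * stuffle s (b ∷ v) + z b * stuffle (k ∷ s) v + merge (weight s v) k b * stuffle s v
    ≡⟨ cong (λ c → z k * stuffle s (b ∷ v) + z b * stuffle (k ∷ s) v + merge c k b * stuffle s v) weight≡t²-t ⟩
  z k * stuffle s (b ∷ v) + z b * stuffle (k ∷ s) v + μ * stuffle s v
    -- The convolution over `b ∷ l` splits by computation into its cut at 0 and the cuts after `b`.
    ≈⟨ +-cong (+-cong (*-congˡ {z k} (stuffle-⋆ u a w (b ∷ l)))
                      (*-congˡ {z b} (stuffle-⋆ (k ∷ u) a w l)))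
              (*-congˡ {μ} (stuffle-⋆ u a w l)) ⟩
  z k * (F [] * G (b ∷ v) + (F ∘ (b ∷_) ⋆ G) l) + z b * (stuffleₒ (k ∷ u) ⋆ G) l + μ * (F ⋆ G) l
    ≈⟨ +-cong (+-cong (≈-trans (distribˡ (z k) (F [] * G (b ∷ v)) ((F ∘ (b ∷_) ⋆ G) l))
                               (+-cong (≈-sym (*-assoc (z k) (F []) (G (b ∷ v)))) (*-⋆ (z k) (F ∘ (b ∷_)) G l)))
                      (*-⋆ (z b) (stuffleₒ (k ∷ u)) G l))
              (*-⋆ μ F G l) ⟩
  z k * F [] * G (b ∷ v) + (F₁ ⋆ G) l + (F₂ ⋆ G) l + (F₃ ⋆ G) l
    ≈⟨ ≈-trans (+-congʳ {(F₃ ⋆ G) l} (+-assoc (z k * F [] * G (b ∷ v)) ((F₁ ⋆ G) l) ((F₂ ⋆ G) l)))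
               (+-assoc (z k * F [] * G (b ∷ v)) ((F₁ ⋆ G) l + (F₂ ⋆ G) l) ((F₃ ⋆ G) l)) ⟩
  z k * F [] * G (b ∷ v) + ((F₁ ⋆ G) l + (F₂ ⋆ G) l + (F₃ ⋆ G) l)
    -- `F₁ r + F₂ r + F₃ r` unfolds from `stuffleₒ (k ∷ u) (b ∷ r)`, which gives all cuts but the
    -- one at 0, whose prefix is empty.
    ≈⟨ +-cong (≈-reflexive (cong (_* G (b ∷ v)) (≡.trans (cong (z k *_) (stuffleₒ-[]ʳ u)) (ι-∷ k u))))
              (≈-sym (≈-trans (⋆-distribʳ-+ (λ r → F₁ r + F₂ r) F₃ G l)
                              (+-congʳ {(F₃ ⋆ G) l} (⋆-distribʳ-+ F₁ F₂ G l)))) ⟩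
  (stuffleₒ (k ∷ u) ⋆ G) (b ∷ l) ∎
  where
  v = toList l
  s = u ++ a ∷ w
  F = stuffleₒ u
  G = lead a w
  μ = merge t²-t k b
  F₁ F₂ F₃ : ZWord → 𝔥
  F₁ r = z k * F (b ∷ r)
  F₂ r = z b * stuffleₒ (k ∷ u) r
  F₃ r = μ * F r
  -- Since `s` still contains `a`, its δ vanishes and the weight computes to `t²-t`: before `a` is
  -- used up, both recursions merge letters alike.
  weight≡t²-t : weight s v ≡ t²-t
  weight≡t²-t = cong (λ d → (1ₜ -ₜ d *ₜ δ v) *ₜ t²-t) (δ-++-∷ u a w)
  open SetoidReasoning setoid

-- Bilinear extension and assembly of the formula.

∗-z⟨⟩ : ∀ u v → z⟨ u ⟩ ∗ z⟨ v ⟩ ≡ stuffle u v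
∗-z⟨⟩ u v = ≡.trans (List.++-identityʳ _) (𝔥ₚ.1#• (stuffle u v))

∗ₒ-z⟨⟩ : ∀ u v → z⟨ u ⟩ ∗ₒ z⟨ v ⟩ ≡ stuffleₒ u v
∗ₒ-z⟨⟩ u v = ≡.trans (List.++-identityʳ _) (𝔥ₚ.1#• (stuffleₒ u v))

module _ {m n : ℕ} (k : Vec ℕ⁺ m) (l : Vec ℕ⁺ n) (j : Fin m) where

  private
    K = toList k
    L = toList l
    u = take (toℕ j) K
    w = drop (suc (toℕ j)) K
    a = lookup k j

  -- The merged letter is the last one before the cut `suc i` in `merged`, but the first one after
  -- the cut `i` in `mergeHead`; hence the shift by one.
  merged-suc : ∀ i → merged k l j (Fin.suc i) * stuffle w (drop (suc (toℕ i)) L)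
                     ↭ stuffleₒ u (take (toℕ i) L) * mergeHead a w (drop (toℕ i) L)
  merged-suc i = begin
    (z⟨ u ⟩ ∗ₒ z⟨ take (toℕ i) L ⟩) * merge c a b * stuffle w v
      ≡⟨ cong₂ (λ p d → p * merge d a b * stuffle w v) (∗ₒ-z⟨⟩ u (take (toℕ i) L)) c≡weight ⟩
    stuffleₒ u (take (toℕ i) L) * merge (weight w v) a b * stuffle w v
      ≈⟨ *-assoc (stuffleₒ u (take (toℕ i) L)) (merge (weight w v) a b) (stuffle w v) ⟩
    stuffleₒ u (take (toℕ i) L) * mergeHead a w (b ∷ v)
      ≡⟨ cong (λ r → stuffleₒ u (take (toℕ i) L) * mergeHead a w r) (drop-lookup l i) ⟨
    stuffleₒ u (take (toℕ i) L) * mergeHead a w (drop (toℕ i) L) ∎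
    where
    open SetoidReasoning setoid
    b = lookup l i
    v = drop (suc (toℕ i)) L
    c = (1ₜ -ₜ δ⟨ suc (toℕ i) , n ⟩ *ₜ δ⟨ suc (toℕ j) , m ⟩) *ₜ t²-t
    c≡weight : c ≡ weight w v
    c≡weight = cong (λ d → (1ₜ -ₜ d) *ₜ t²-t) (≡.trans
      (δ⟨⟩-*ₜ-comm (suc (toℕ i)) n (suc (toℕ j)) m)
      (≡.sym (cong₂ _*ₜ_ (δ-drop k j) (δ-drop l i))))

  -- The shift by one costs nothing at the ends: `merged` vanishes at the cut 0, and `mergeHead` at
  -- the cut `n`, where no letter is left to merge with.
  sum-merged : sum {suc n} (λ i → merged k l j i * stuffle w (drop (toℕ i) L)) ↭ (stuffleₒ u ⋆ mergeHead a w) l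
  sum-merged = begin
    -- The summand at the cut 0 has already vanished by computation.
    sum {n} (λ i → merged k l j (Fin.suc i) * stuffle w (drop (suc (toℕ i)) L))
      ≈⟨ sum-cong-≋ merged-suc ⟩
    sum {n} (f ∘ toℕ)
      ≈⟨ sum-cong-≋ {n} (λ i → ≈-reflexive (cong f (≡.sym (toℕ-inject₁ i)))) ⟩
    sum {n} (f ∘ toℕ ∘ inject₁)
      ≈⟨ +-identityʳ _ ⟨
    sum {n} (f ∘ toℕ ∘ inject₁) + 𝔥.0#
      ≈⟨ +-congˡ {sum {n} (f ∘ toℕ ∘ inject₁)} f-last ⟨
    sum {n} (f ∘ toℕ ∘ inject₁) + f (toℕ (fromℕ n))
      ≈⟨ sum-init-last (f ∘ toℕ) ⟨
    sum {suc n} (f ∘ toℕ) ∎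
    where
    open SetoidReasoning setoid
    f : ℕ → 𝔥
    f i = stuffleₒ u (take i L) * mergeHead a w (drop i L)
    f-last : f (toℕ (fromℕ n)) ↭ 𝔥.0#
    f-last = ≈-reflexive (≡.trans
      (cong (λ v → stuffleₒ u (take (toℕ (fromℕ n)) L) * mergeHead a w v)
            (≡.trans (cong (λ i → drop i L) (toℕ-fromℕ n)) (drop-length l)))
      (List.cartesianProductWith-zeroʳ _ (stuffleₒ u (take (toℕ (fromℕ n)) L))))

  ∗-↭ : z⟨ K ⟩ ∗ z⟨ L ⟩ ↭ sum {suc n} (λ i →
          ((z⟨ u ⟩ ∗ₒ z⟨ take (toℕ i) L ⟩) * z a + merged k l j i) * (z⟨ w ⟩ ∗ z⟨ drop (toℕ i) L ⟩))
  ∗-↭ = begin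
    z⟨ K ⟩ ∗ z⟨ L ⟩
      ≡⟨ ∗-z⟨⟩ K L ⟩
    stuffle K L
      ≡⟨ cong (λ s → stuffle s L) (≡.trans (cong (u ++_) (≡.sym (drop-lookup k j))) (List.take++drop≡id (toℕ j) K)) ⟨
    stuffle (u ++ a ∷ w) L
      ≈⟨ stuffle-⋆ u a w l ⟩
    (stuffleₒ u ⋆ lead a w) l
      ≈⟨ sum-cong-≋ {suc n} (λ i → distribˡ (F i) (z a * B i) (mergeHead a w (drop (toℕ i) L))) ⟩
    -- Only the merged part has to be shifted, so the sum is split here and rejoined once
    -- `sum-merged` has been applied.
    sum {suc n} (λ i → F i * (z a * B i) + F i * mergeHead a w (drop (toℕ i) L))
      ≈⟨ ∑-distrib-+ {suc n} (λ i → F i * (z a * B i)) (λ i → F i * mergeHead a w (drop (toℕ i) L)) ⟩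
    sum {suc n} (λ i → F i * (z a * B i)) + (stuffleₒ u ⋆ mergeHead a w) l
      ≈⟨ +-cong (sum-cong-≋ {suc n} (λ i → ≈-sym (*-assoc (F i) (z a) (B i)))) (≈-sym sum-merged) ⟩
    sum {suc n} (λ i → F i * z a * B i) + sum {suc n} (λ i → merged k l j i * B i)
      ≈⟨ ∑-distrib-+ {suc n} (λ i → F i * z a * B i) (λ i → merged k l j i * B i) ⟨
    sum {suc n} (λ i → F i * z a * B i + merged k l j i * B i)
      ≈⟨ sum-cong-≋ {suc n} (λ i → ≈-sym (distribʳ (B i) (F i * z a) (merged k l j i))) ⟩
    sum {suc n} (λ i → (F i * z a + merged k l j i) * B i)
      ≈⟨ sum-cong-≋ {suc n} (λ i → ≈-reflexive (cong₂ (λ p q → (p * z a + merged k l j i) * q)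
           (∗ₒ-z⟨⟩ u (take (toℕ i) L)) (∗-z⟨⟩ w (drop (toℕ i) L)))) ⟨
    sum {suc n} (λ i → ((z⟨ u ⟩ ∗ₒ z⟨ take (toℕ i) L ⟩) * z a + merged k l j i) * (z⟨ w ⟩ ∗ z⟨ drop (toℕ i) L ⟩)) ∎
    where
    open SetoidReasoning setoid
    F B : Fin (suc n) → 𝔥
    F i = stuffleₒ u (take (toℕ i) L)
    B i = stuffle w (drop (toℕ i) L)

proposition2 : (m n : ℕ) .{{_ : NonZero m}} .{{_ : NonZero n}}
    (k : Vec ℕ⁺ m) (l : Vec ℕ⁺ n) (j : Fin m) →
    z⟨ toList k ⟩ ∗ z⟨ toList l ⟩
      ≈ sum {suc n} (λ i →
          ( (z⟨ take (toℕ j) (toList k) ⟩ ∗ₒ z⟨ take (toℕ i) (toList l) ⟩) * z (lookup k j)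
          + merged k l j i)
          * (z⟨ drop (suc (toℕ j)) (toList k) ⟩ ∗ z⟨ drop (toℕ i) (toList l) ⟩))
proposition2 m n k l j = 𝔥ₚ.↭⇒≈ (∗-↭ k l j)
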